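{- Let $G$ be a processive graph with a linear order $\prec$ on $E(G)$ satisfying $(P_1)$ $e_1\rightarrow e_2$ implies $e_1\prec e_2$. Then the following statements are equivalent: (1) $(G,\prec)$ is a POP-graph. (2) $\prec$ satisfies $(U_2)$ and $(P_3)$. (3) $(G,\prec)$ is an anchored UPO-graph. (4) $\prec$ satisfies $(U_2)$, $(U_3)$ and $(U_4)$. Here the conditions are: $(U_2)$ for any vertex $v$, $\overline{I(v)}\cap\overline{O(v)}=\emptyset$ and $\overline{E(v)}=\overline{I(v)}\sqcup\overline{O(v)}$; $(U_3)$ for any two vertices $v_1,v_2$, $I(v_1)\cap\overline{I(v_2)}\neq\emptyset$ implies $\overline{I(v_1)}\subseteq\overline{I(v_2)}$, and $O(v_1)\cap\overline{O(v_2)}\neq\emptyset$ implies $\overline{O(v_1)}\subseteq\overline{O(v_2)}$; $(U_4)$ for any processive vertex $v$ of $G$, $I(G)\cap\overline{O(v)}=\emptyset$ and $O(G)\cap\overline{I(v)}=\emptyset$; $(P_3)$ for any two distinct vertices $v_1,v_2$, $I(v_1)\cap\overline{I(v_2)}\neq\emptyset$ implies $v_1\rightarrow v_2$, and $O(v_1)\cap\overline{O(v_2)}\neq\emptyset$ implies $v_2\rightarrow v_1$.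
   Context: Directed graphs are finite; parallel edges are allowed. For a vertex $v$, $I(v)$ and $O(v)$ are the sets of incoming and outgoing edges and $E(v)=I(v)\cup O(v)$. A source (sink) is a vertex with no incoming (outgoing) edge. A processive graph is an acyclic directed graph in which all sources and sinks have degree one; a vertex is processive if it is neither a source nor a sink. $I(G)$ is the set of input edges (edges starting from a source) and $O(G)$ the set of output edges (edges ending with a sink). For edges $e_1\ne e_2$, $e_1\rightarrow e_2$ means there is a directed path with first edge $e_1$ and last edge $e_2$; for vertices, $v\rightarrow w$ means there is a (nontrivial) directed path starting from $v$ and ending with $w$. For a finite set with a linear order $\prec$ and nonempty subset $X$, $X^-=\min X$, $X^+=\max X$, $\overline{X}=\{y: X^-\preceq y\preceq X^+\}$; $\overline{\emptyset}=\emptyset$. A planar order on a processive graph $G$ is a linear order $\prec$ on $E(G)$ such that $(P_1)$ $e_1\rightarrow e_2$ implies $e_1\prec e_2$; $(P_2)$ if $e_1\prec e_2\prec e_3$ and $e_1\rightarrow e_3$, then $e_1\rightarrow e_2$ or $e_2\rightarrow e_3$. A POP-graph is a processive graph together with a planar order. An upward planar order on a directed graph $G$ is a linear order $\prec$ on $E(G)$ satisfying $(U_1)=(P_1)$, $(U_2)$ and $(U_3)$; a UPO-graph is a directed graph with an upward planar order. A UPO-graph is anchored if $(A)$: for any different vertices $v_1,v_2$, $\emptyset\neq\overline{I(v_1)}\subset\overline{I(v_2)}$ implies $v_1\rightarrow v_2$, and $\emptyset\neq\overline{O(v_1)}\subset\overline{O(v_2)}$ implies $v_2\rightarrow v_1$.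 -}

module Defs where

open import Level using (0ℓ)
open import Data.Nat.Base using (ℕ; _+_)
open import Data.Fin.Base using (Fin)
open import Data.Fin.Properties using (_≟_)
open import Data.List.Base using (length; filter; allFin)
open import Data.Product.Base using (∃₂; _×_)
open import Data.Sum.Base using (_⊎_)
open import Relation.Binary.Core using (Rel)
open import Relation.Binary.Structures using (IsStrictTotalOrder)
open import Relation.Binary.Construct.Closure.ReflexiveTransitive using (Star)
import Relation.Binary.Construct.StrictToNonStrict as StrictToNonStrict
open import Relation.Binary.PropositionalEquality.Core using (_≡_; _≢_)
open import Relation.Nullary.Negation.Core using (¬_)
open import Relation.Unary
  using (Pred; _∈_; _⊆_; _⊂_; _≐_; _∪_; _≬_; _⊥_; Empty; Satisfiable)

record DirectedGraph : Set where
  field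
    #vertices : ℕ
    #edges    : ℕ

  Vertex : Set
  Vertex = Fin #vertices

  Edge : Set
  Edge = Fin #edges

  field
    src tgt : Edge → Vertex

  I O E : Vertex → Pred Edge 0ℓ
  I v e = tgt e ≡ v
  O v e = src e ≡ v
  E v   = I v ∪ O v

  inDegree outDegree degree : Vertex → ℕ
  inDegree  v = length (filter (λ e → tgt e ≟ v) (allFin #edges))
  outDegree v = length (filter (λ e → src e ≟ v) (allFin #edges))
  degree    v = inDegree v + outDegree v

  Source Sink Processive : Pred Vertex 0ℓ
  Source     v = Empty (I v)
  Sink       v = Empty (O v)
  Processive v = ¬ Source v × ¬ Sink v

  Input Output : Pred Edge 0ℓ
  Input  e = Source (src e)
  Output e = Sink (tgt e)

  -- A directed path is a nonempty sequence of consecutive edges.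
  -- `DirectedPath e f` consists of those with first edge e and last edge f; the
  -- reflexive case is the path with a single edge.  Vertices may be repeated,
  -- which makes no difference in an acyclic graph.
  DirectedPath : Rel Edge 0ℓ
  DirectedPath = Star (λ e f → tgt e ≡ src f)

  infix 4 _→ᵉ_ _→ᵛ_

  _→ᵉ_ : Rel Edge 0ℓ
  e₁ →ᵉ e₂ = e₁ ≢ e₂ × DirectedPath e₁ e₂

  _→ᵛ_ : Rel Vertex 0ℓ
  v →ᵛ w = ∃₂ λ e f → src e ≡ v × DirectedPath e f × tgt f ≡ w

  Acyclic : Set
  Acyclic = ∀ v → ¬ (v →ᵛ v)

record IsProcessive (G : DirectedGraph) : Set where
  open DirectedGraph G
  field
    acyclic       : Acyclic
    source-degree : ∀ v → Source v → degree v ≡ 1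
    sink-degree   : ∀ v → Sink v → degree v ≡ 1

module _ {A : Set} (_≺_ : Rel A 0ℓ) where

  open StrictToNonStrict _≡_ _≺_ using () renaming (_≤_ to _⪯_)

  IsMin IsMax : Pred A 0ℓ → Pred A 0ℓ
  IsMin X x = x ∈ X × (∀ y → y ∈ X → x ⪯ y)
  IsMax X x = x ∈ X × (∀ y → y ∈ X → y ⪯ x)

  -- The set written X with an overline: { y | X⁻ ⪯ y ⪯ X⁺ }.  An empty X has no
  -- minimum, so its hull is empty, as required.
  hull : Pred A 0ℓ → Pred A 0ℓ
  hull X y = ∃₂ λ X⁻ X⁺ → IsMin X X⁻ × IsMax X X⁺ × X⁻ ⪯ y × y ⪯ X⁺

module _ (G : DirectedGraph) (_≺_ : Rel (DirectedGraph.Edge G) 0ℓ) where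

  open DirectedGraph G

  P₁ : Set
  P₁ = ∀ e₁ e₂ → e₁ →ᵉ e₂ → e₁ ≺ e₂

  P₂ : Set
  P₂ = ∀ e₁ e₂ e₃ → e₁ ≺ e₂ → e₂ ≺ e₃ → e₁ →ᵉ e₃ → e₁ →ᵉ e₂ ⊎ e₂ →ᵉ e₃

  P₃ : Set
  P₃ = ∀ v₁ v₂ → v₁ ≢ v₂ →
       (I v₁ ≬ hull _≺_ (I v₂) → v₁ →ᵛ v₂) ×
       (O v₁ ≬ hull _≺_ (O v₂) → v₂ →ᵛ v₁)

  U₁ : Set
  U₁ = P₁

  U₂ : Set
  U₂ = ∀ v →
       hull _≺_ (I v) ⊥ hull _≺_ (O v) ×
       hull _≺_ (E v) ≐ hull _≺_ (I v) ∪ hull _≺_ (O v)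

  U₃ : Set
  U₃ = ∀ v₁ v₂ →
       (I v₁ ≬ hull _≺_ (I v₂) → hull _≺_ (I v₁) ⊆ hull _≺_ (I v₂)) ×
       (O v₁ ≬ hull _≺_ (O v₂) → hull _≺_ (O v₁) ⊆ hull _≺_ (O v₂))

  U₄ : Set
  U₄ = ∀ v → Processive v →
       Input ⊥ hull _≺_ (O v) ×
       Output ⊥ hull _≺_ (I v)

  -- The inclusions are strict.  For v₁ ≢ v₂ this is the same as asking for ⊆,
  -- since two distinct vertices cannot have equal nonempty hulls here: the hulls
  -- would share their minimum, which would be an edge at both vertices.
  Anchored : Set
  Anchored = ∀ v₁ v₂ → v₁ ≢ v₂ →
    (Satisfiable (hull _≺_ (I v₁)) → hull _≺_ (I v₁) ⊂ hull _≺_ (I v₂) → v₁ →ᵛ v₂) ×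
    (Satisfiable (hull _≺_ (O v₁)) → hull _≺_ (O v₁) ⊂ hull _≺_ (O v₂) → v₂ →ᵛ v₁)

  record IsPOPGraph : Set where
    field
      isProcessive       : IsProcessive G
      isStrictTotalOrder : IsStrictTotalOrder _≡_ _≺_
      p₁                 : P₁
      p₂                 : P₂

  record IsUPOGraph : Set where
    field
      isStrictTotalOrder : IsStrictTotalOrder _≡_ _≺_
      u₁                 : U₁
      u₂                 : U₂
      u₃                 : U₃

  record IsAnchoredUPOGraph : Set where
    field
      isUPOGraph : IsUPOGraph
      anchored   : Anchored

{-# OPTIONS --safe #-}

-- The edge-wise content is in two steps.  For P₂ from U₂ and P₃: if e₁ ≺ e₂ ≺ e₃ and
-- a path leads from e₁ to e₃, then e₂ lies between two consecutive edges of that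
-- path, meeting in a vertex v; by U₂ it lies in the hull of I(v) or of O(v), and P₃
-- joins its endpoint to v.  For P₃ from U₂, U₃ and U₄: an edge f in the hull of I(v)
-- that does not end in v is not an output edge by U₄, and by U₂ and U₃ some edge
-- leaving its target is still in that hull; since edges increase along a path,
-- iterating this reaches v.
--
-- Every argument about incoming edges applies to outgoing edges after reversing
-- both the graph and the order.

module Submission where

open import Defs
open import Level using (0ℓ)
open import Data.Empty using (⊥-elim)
open import Data.Fin.Base using (Fin)
open import Data.Fin.Induction using (spo-wellFounded; spo-noetherian)
open import Data.Fin.Properties using (_≟_; any?)
open import Data.List.Base using (List; []; _∷_; length)
open import Data.List.Membership.Propositional using () renaming (_∈_ to _∈ˡ_)
open import Data.List.Membership.Propositional.Properties using (∈-filter⁺; ∈-allFin)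
open import Data.List.Relation.Unary.Any using (here)
import Data.Nat.Base as ℕ
import Data.Nat.Properties as ℕ
open import Data.Product.Base using (∃; _×_; _,_; proj₁; proj₂; swap)
open import Data.Sum.Base as Sum using (_⊎_; inj₁; inj₂)
open import Function.Base using (flip; _∘_)
open import Function.Bundles using (_⇔_; mk⇔; Equivalence)
open import Induction.WellFounded using (Acc; acc)
open import Relation.Binary.Core using (Rel)
open import Relation.Binary.Definitions using (tri<; tri≈; tri>)
open import Relation.Binary.Structures using (IsStrictTotalOrder; IsTotalOrder)
import Relation.Binary.Construct.Flip.EqAndOrd as Flip
import Relation.Binary.Construct.StrictToNonStrict as StrictToNonStrict
open import Relation.Binary.Construct.Closure.ReflexiveTransitive
  using (ε; _◅_; _◅◅_; reverse)
open import Relation.Binary.PropositionalEquality.Core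
  using (_≡_; _≢_; refl; sym; trans; subst)
open import Relation.Nullary.Decidable.Core using (yes; no; _×-dec_)
open import Relation.Nullary.Negation.Core using (¬_)
open import Relation.Unary
  using (Pred; Decidable; _∈_; _⊆_; _⊂_; _∪_; _≬_; _⊥_; Satisfiable)
open import Relation.Unary.Properties using (_∪?_)

-- Extrema and hulls in finite linear orders.

length≤1⇒≡ : ∀ {A : Set} {xs : List A} {x y} →
             length xs ℕ.≤ 1 → x ∈ˡ xs → y ∈ˡ xs → x ≡ y
length≤1⇒≡ {xs = _ ∷ []} _ (here refl) (here refl) = refl
length≤1⇒≡ {xs = _ ∷ _ ∷ _} (ℕ.s≤s ())

-- Reversal exchanges minimum and maximum. As `flip (flip _≺_)` is `_≺_` by definition, this one
-- inclusion serves both directions.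
hull-flip : ∀ {A : Set} {_≺_ : Rel A 0ℓ} {X} → hull _≺_ X ⊆ hull (flip _≺_) X
hull-flip (m , M , (m∈ , m≤) , (M∈ , ≤M) , m≤y , y≤M) =
  M , m , (M∈ , λ y y∈ → Sum.map₂ sym (≤M y y∈)) , (m∈ , λ y y∈ → Sum.map₂ sym (m≤ y y∈)) ,
  Sum.map₂ sym y≤M , Sum.map₂ sym m≤y

-- Descend from `x` as long as `X` has a smaller member; on a finite type this stops.
minimum : ∀ {n} {_≺_ : Rel (Fin n) 0ℓ} → IsStrictTotalOrder _≡_ _≺_ →
          ∀ {X : Pred (Fin n) 0ℓ} → Decidable X → ∀ {x} → x ∈ X → ∃ (IsMin _≺_ X)
minimum {n} {_≺_} sto {X} X? {x} x∈ = go x∈ (spo-wellFounded isStrictPartialOrder x)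
  where
  open IsStrictTotalOrder sto using (compare; isStrictPartialOrder; _<?_)
  open StrictToNonStrict _≡_ _≺_ using () renaming (_≤_ to _⪯_)

  go : ∀ {x} → x ∈ X → Acc _≺_ x → ∃ (IsMin _≺_ X)
  go {x} x∈ (acc rs) with any? (λ y → X? y ×-dec (y <? x))
  ... | yes (y , y∈ , y≺x) = go y∈ (rs y≺x)
  ... | no ¬∃              = x , x∈ , x⪯
    where
    x⪯ : ∀ y → y ∈ X → x ⪯ y
    x⪯ y y∈ with compare x y
    ... | tri< x≺y _ _ = inj₁ x≺y
    ... | tri≈ _ x≡y _ = inj₂ x≡y
    ... | tri> _ _ y≺x = ⊥-elim (¬∃ (y , y∈ , y≺x))

maximum : ∀ {n} {_≺_ : Rel (Fin n) 0ℓ} → IsStrictTotalOrder _≡_ _≺_ →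
          ∀ {X : Pred (Fin n) 0ℓ} → Decidable X → ∀ {x} → x ∈ X → ∃ (IsMax _≺_ X)
maximum sto X? x∈ with minimum (Flip.isStrictTotalOrder sto) X? x∈
... | M , M∈ , ≤M = M , M∈ , λ y y∈ → Sum.map₂ sym (≤M y y∈)

module Hull {n} {_≺_ : Rel (Fin n) 0ℓ} (sto : IsStrictTotalOrder _≡_ _≺_) where

  open IsStrictTotalOrder sto using (irrefl) renaming (trans to ≺-trans)
  open StrictToNonStrict _≡_ _≺_ using () renaming (_≤_ to _⪯_)
  open IsTotalOrder (StrictToNonStrict.isTotalOrder _≡_ _≺_ sto) public
    using () renaming (trans to ⪯-trans; antisym to ⪯-antisym; total to ⪯-total)

  ≺-⪯-trans : ∀ {x y z} → x ≺ y → y ⪯ z → x ≺ z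
  ≺-⪯-trans x≺y (inj₁ y≺z)  = ≺-trans x≺y y≺z
  ≺-⪯-trans x≺y (inj₂ refl) = x≺y

  ≺⇒⋡ : ∀ {x y} → x ≺ y → ¬ (y ⪯ x)
  ≺⇒⋡ x≺y y⪯x = irrefl refl (≺-⪯-trans x≺y y⪯x)

  ⪯∧≢⇒≺ : ∀ {x y} → x ⪯ y → x ≢ y → x ≺ y
  ⪯∧≢⇒≺ (inj₁ x≺y) _   = x≺y
  ⪯∧≢⇒≺ (inj₂ x≡y) x≢y = ⊥-elim (x≢y x≡y)

  -- Only the two extremes of `X` matter: they lie between those of `Y`, so everything between them
  -- does too.
  hull-least : ∀ {X Y} → X ⊆ hull _≺_ Y → hull _≺_ X ⊆ hull _≺_ Y
  hull-least X⊆ (m , M , (m∈ , _) , (M∈ , _) , m⪯y , y⪯M) with X⊆ m∈ | X⊆ M∈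
  ... | a , _ , a-min , _ , a⪯m , _ | _ , b , _ , b-max , _ , M⪯b =
    a , b , a-min , b-max , ⪯-trans a⪯m m⪯y , ⪯-trans y⪯M M⪯b

  hull-intro : ∀ {X : Pred (Fin n) 0ℓ} → Decidable X →
               ∀ {a b y} → a ∈ X → b ∈ X → a ⪯ y → y ⪯ b → y ∈ hull _≺_ X
  hull-intro X? a∈ b∈ a⪯y y⪯b with minimum sto X? a∈ | maximum sto X? b∈
  ... | m , m-min | M , M-max =
    m , M , m-min , M-max , ⪯-trans (proj₂ m-min _ a∈) a⪯y , ⪯-trans y⪯b (proj₂ M-max _ b∈)

  ⊆-hull : ∀ {X : Pred (Fin n) 0ℓ} → Decidable X → X ⊆ hull _≺_ X
  ⊆-hull X? x∈ = hull-intro X? x∈ x∈ (inj₂ refl) (inj₂ refl)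

-- Directed paths and their truncations.

module Paths (G : DirectedGraph) where

  open DirectedGraph G

  I? : ∀ v → Decidable (I v)
  I? v e = tgt e ≟ v

  O? : ∀ v → Decidable (O v)
  O? v e = src e ≟ v

  →ᵛ-trans : ∀ {u v w} → u →ᵛ v → v →ᵛ w → u →ᵛ w
  →ᵛ-trans (e , _ , e∈ , p , f∈) (_ , h , g∈ , q , h∈) =
    e , h , e∈ , p ◅◅ (trans f∈ (sym g∈) ◅ q) , h∈

  path⇒tgt→ᵛ : ∀ {e f} → DirectedPath e f → tgt e ≢ tgt f → tgt e →ᵛ tgt f
  path⇒tgt→ᵛ ε       t≢t = ⊥-elim (t≢t refl)
  path⇒tgt→ᵛ (s ◅ p) _   = _ , _ , sym s , p , refl

  -- `Star` is built from the front, so dropping the last edge takes a recursion, which stops once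
  -- the next edge is `f`.
  path-init : ∀ {e f} → DirectedPath e f → e ≢ f →
              ∃ λ g → DirectedPath e g × tgt g ≡ src f
  path-init ε e≢e = ⊥-elim (e≢e refl)
  path-init {e} {f} (_◅_ {j = g} s p) _ with g ≟ f
  ... | yes refl = e , ε , s
  ... | no g≢f with path-init p g≢f
  ...   | h , q , t = h , s ◅ q , t

  outgoing : ∀ {v} → ¬ Sink v → ∃ (O v)
  outgoing {v} ¬sink with any? (O? v)
  ... | yes o  = o
  ... | no ¬∃  = ⊥-elim (¬sink λ e e∈ → ¬∃ (e , e∈))

-- Reversal of graph and order.

infix 8 _ᵒᵖ

_ᵒᵖ : DirectedGraph → DirectedGraph
G ᵒᵖ = record { #vertices = #vertices ; #edges = #edges ; src = tgt ; tgt = src }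
  where open DirectedGraph G

reverse-→ᵛ : ∀ G {v w} → DirectedGraph._→ᵛ_ G v w → DirectedGraph._→ᵛ_ (G ᵒᵖ) w v
reverse-→ᵛ G (e , f , e∈ , p , f∈) = f , e , f∈ , reverse sym p , e∈

isProcessive-op : ∀ {G} → IsProcessive G → IsProcessive (G ᵒᵖ)
isProcessive-op {G} proc = record
  { acyclic       = λ v → acyclic v ∘ reverse-→ᵛ (G ᵒᵖ)
  ; source-degree = λ v s → trans (ℕ.+-comm (outDegree v) _) (sink-degree v s)
  ; sink-degree   = λ v s → trans (ℕ.+-comm (outDegree v) _) (source-degree v s)
  }
  where
  open IsProcessive proc
  open DirectedGraph G

module _ (G : DirectedGraph) (_≺_ : Rel (DirectedGraph.Edge G) 0ℓ) where

  open DirectedGraph G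

  -- The first four are the incoming halves of the conditions; the outgoing halves correspond to the
  -- same statements for `G ᵒᵖ` and `flip _≺_`.
  P₃ᴵ U₃ᴵ U₄ᴵ Anchoredᴵ Splitting : Set
  P₃ᴵ = ∀ v₁ v₂ → v₁ ≢ v₂ → I v₁ ≬ hull _≺_ (I v₂) → v₁ →ᵛ v₂
  U₃ᴵ = ∀ v₁ v₂ → I v₁ ≬ hull _≺_ (I v₂) → hull _≺_ (I v₁) ⊆ hull _≺_ (I v₂)
  U₄ᴵ = ∀ v → Processive v → Output ⊥ hull _≺_ (I v)
  Anchoredᴵ = ∀ v₁ v₂ → v₁ ≢ v₂ → Satisfiable (hull _≺_ (I v₁)) →
              hull _≺_ (I v₁) ⊂ hull _≺_ (I v₂) → v₁ →ᵛ v₂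

  -- The part of U₂ that does not already follow from P₁.
  Splitting = ∀ {v i y o} → i ∈ I v → o ∈ O v → i ≺ y → y ≺ o →
              y ∈ hull _≺_ (I v) ∪ hull _≺_ (O v)

module Duality (G : DirectedGraph) (_≺_ : Rel (DirectedGraph.Edge G) 0ℓ) where

  P₁-op : P₁ G _≺_ → P₁ (G ᵒᵖ) (flip _≺_)
  P₁-op p₁ e f (e≢f , p) = p₁ f e (e≢f ∘ sym , reverse sym p)

  P₂-op : P₂ G _≺_ → P₂ (G ᵒᵖ) (flip _≺_)
  P₂-op p₂ e f g f≺e g≺f (e≢g , p) =
    Sum.swap (Sum.map op op (p₂ g f e g≺f f≺e (e≢g ∘ sym , reverse sym p)))
    where
    op : ∀ {e f} → DirectedGraph._→ᵉ_ G e f → DirectedGraph._→ᵉ_ (G ᵒᵖ) f e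
    op (e≢f , p) = e≢f ∘ sym , reverse sym p

  Splitting-op : Splitting G _≺_ → Splitting (G ᵒᵖ) (flip _≺_)
  Splitting-op split i∈ o∈ y≺i o≺y =
    Sum.swap (Sum.map hull-flip hull-flip (split o∈ i∈ o≺y y≺i))

  P₃⇔ : P₃ G _≺_ ⇔ (P₃ᴵ G _≺_ × P₃ᴵ (G ᵒᵖ) (flip _≺_))
  P₃⇔ = mk⇔
    (λ p₃ → (λ v w v≢w → proj₁ (p₃ v w v≢w)) ,
            (λ v w v≢w (e , e∈ , h) → reverse-→ᵛ G (proj₂ (p₃ v w v≢w) (e , e∈ , hull-flip h))))
    (λ (p , q) v w v≢w → p v w v≢w ,
            (λ (e , e∈ , h) → reverse-→ᵛ (G ᵒᵖ) (q v w v≢w (e , e∈ , hull-flip h))))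

  U₃⇔ : U₃ G _≺_ ⇔ (U₃ᴵ G _≺_ × U₃ᴵ (G ᵒᵖ) (flip _≺_))
  U₃⇔ = mk⇔
    (λ u₃ → (λ v w → proj₁ (u₃ v w)) ,
            (λ v w (e , e∈ , h) → hull-flip ∘ proj₂ (u₃ v w) (e , e∈ , hull-flip h) ∘ hull-flip))
    (λ (p , q) v w → p v w ,
            (λ (e , e∈ , h) → hull-flip ∘ q v w (e , e∈ , hull-flip h) ∘ hull-flip))

  U₄⇔ : U₄ G _≺_ ⇔ (U₄ᴵ G _≺_ × U₄ᴵ (G ᵒᵖ) (flip _≺_))
  U₄⇔ = mk⇔
    (λ u₄ → (λ v v-proc → proj₂ (u₄ v v-proc)) ,
            (λ v v-proc {_} (e∈ , h) → proj₁ (u₄ v (swap v-proc)) (e∈ , hull-flip h)))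
    (λ (p , q) v v-proc →
            (λ {_} (e∈ , h) → q v (swap v-proc) (e∈ , hull-flip h)) , p v v-proc)

  Anchored⇔ : Anchored G _≺_ ⇔ (Anchoredᴵ G _≺_ × Anchoredᴵ (G ᵒᵖ) (flip _≺_))
  Anchored⇔ = mk⇔
    (λ a → (λ v w v≢w → proj₁ (a v w v≢w)) ,
           (λ v w v≢w (e , h) (v⊆w , w⊈v) → reverse-→ᵛ G
             (proj₂ (a v w v≢w) (e , hull-flip h)
               (hull-flip ∘ v⊆w ∘ hull-flip , λ w⊆v → w⊈v (hull-flip ∘ w⊆v ∘ hull-flip)))))
    (λ (p , q) v w v≢w → p v w v≢w ,
           (λ (e , h) (v⊆w , w⊈v) → reverse-→ᵛ (G ᵒᵖ)
             (q v w v≢w (e , hull-flip h)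
               (hull-flip ∘ v⊆w ∘ hull-flip , λ w⊆v → w⊈v (hull-flip ∘ w⊆v ∘ hull-flip)))))

-- Implications between the conditions on incoming edges.

module Incoming (G : DirectedGraph) (isProcessive : IsProcessive G)
  (_≺_ : Rel (DirectedGraph.Edge G) 0ℓ) (sto : IsStrictTotalOrder _≡_ _≺_)
  (p₁ : P₁ G _≺_) where

  open DirectedGraph G
  open IsProcessive isProcessive
  open Paths G
  open IsStrictTotalOrder sto using (compare; irrefl; isStrictPartialOrder)
    renaming (trans to ≺-trans)
  open StrictToNonStrict _≡_ _≺_ using () renaming (_≤_ to _⪯_)
  open Hull sto

  path⇒⪯ : ∀ {e f} → DirectedPath e f → e ⪯ f
  path⇒⪯ {e} {f} p with e ≟ f
  ... | yes e≡f = inj₂ e≡f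
  ... | no  e≢f = inj₁ (p₁ e f (e≢f , p))

  consecutive⇒≺ : ∀ {e f} → tgt e ≡ src f → e ≺ f
  consecutive⇒≺ {e} {f} s = p₁ e f (e≢f , s ◅ ε)
    where
    e≢f : e ≢ f
    e≢f refl = acyclic (tgt e) (e , e , sym s , ε , refl)

  -- Degree one leaves at most one entry in the list of edges counted by `inDegree`.
  sink⇒I-unique : ∀ {v} → Sink v → ∀ {e f} → e ∈ I v → f ∈ I v → e ≡ f
  sink⇒I-unique {v} sink e∈ f∈ = length≤1⇒≡
    (subst (inDegree v ℕ.≤_) (sink-degree v sink) (ℕ.m≤m+n _ _))
    (∈-filter⁺ (I? v) (∈-allFin _) e∈) (∈-filter⁺ (I? v) (∈-allFin _) f∈)

  between⇒processive : ∀ {v a b e} → a ∈ I v → b ∈ I v → a ≺ e → e ≺ b → Processive v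
  between⇒processive a∈ b∈ a≺e e≺b =
    (λ source → source _ a∈) ,
    (λ sink → irrefl (sink⇒I-unique sink a∈ b∈) (≺-trans a≺e e≺b))

  hull-bounds : ∀ {v e} → tgt e ≢ v → e ∈ hull _≺_ (I v) →
                ∃ λ a → ∃ λ b → a ∈ I v × IsMax _≺_ (I v) b × a ≺ e × e ≺ b
  hull-bounds t≢v (a , b , (a∈ , _) , b-max@(b∈ , _) , a⪯e , e⪯b) =
    a , b , a∈ , b-max , ⪯∧≢⇒≺ a⪯e (λ { refl → t≢v a∈ }) , ⪯∧≢⇒≺ e⪯b (λ { refl → t≢v b∈ })

  -- With `e` strictly between `a` and `b` in `I w`, the vertex `w` is not a sink; apply `P₂` to
  -- `a ≺ e ≺ o` for an edge `o` leaving `w`. A path from `a` to `e` would continue with an edge out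
  -- of `w`, forcing `b ≺ e`. So `e` leads to `o`, and the path without `o` ends in `w`.
  P₂⇒P₃ᴵ : P₂ G _≺_ → P₃ᴵ G _≺_
  P₂⇒P₃ᴵ p₂ v w v≢w (e , refl , e∈) with hull-bounds v≢w e∈
  ... | a , b , refl , (b∈ , _) , a≺e , e≺b
    with outgoing (proj₂ (between⇒processive refl b∈ a≺e e≺b))
  ... | o , o∈ = go (p₂ a e o a≺e e≺o (a≢o , sym o∈ ◅ ε))
    where
    e≺o : e ≺ o
    e≺o = ≺-trans e≺b (consecutive⇒≺ (trans b∈ (sym o∈)))

    a≢o : a ≢ o
    a≢o a≡o = irrefl a≡o (≺-trans a≺e e≺o)

    go : a →ᵉ e ⊎ e →ᵉ o → tgt e →ᵛ tgt a
    go (inj₁ (a≢e , ε))     = ⊥-elim (a≢e refl)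
    go (inj₁ (_   , s ◅ p)) =
      ⊥-elim (≺⇒⋡ e≺b (inj₁ (≺-⪯-trans (consecutive⇒≺ (trans b∈ s)) (path⇒⪯ p))))
    go (inj₂ (e≢o , p)) with path-init p e≢o
    ... | i , q , i∈ = subst (tgt e →ᵛ_) (trans i∈ o∈)
      (path⇒tgt→ᵛ q λ t≡t → v≢w (trans t≡t (trans i∈ o∈)))

  -- For `v ≢ w`, `P₃ᴵ` gives a path from `v` to `w`, so each edge into `v` precedes some edge into
  -- `w`. This bounds `I v` above; the lower bound comes from acyclicity.
  P₃ᴵ⇒U₃ᴵ : P₃ᴵ G _≺_ → U₃ᴵ G _≺_
  P₃ᴵ⇒U₃ᴵ p₃ v w (e , e∈v , e∈w@(a , b , a-min , b-max , a⪯e , _)) with v ≟ w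
  ... | yes refl = λ y∈ → y∈
  ... | no v≢w   = hull-least λ x∈ → a , b , a-min , b-max , lower x∈ , upper x∈
    where
    v→w : v →ᵛ w
    v→w = p₃ v w v≢w (e , e∈v , e∈w)

    upper : ∀ {x} → x ∈ I v → x ⪯ b
    upper x∈ with v→w
    ... | f , g , f∈ , p , g∈ =
      inj₁ (≺-⪯-trans (consecutive⇒≺ (trans x∈ (sym f∈))) (⪯-trans (path⇒⪯ p) (proj₂ b-max g g∈)))

    lower : ∀ {x} → x ∈ I v → a ⪯ x
    lower {x} x∈ with ⪯-total a x
    ... | inj₁ a⪯x = a⪯x
    -- Here `a`, an edge into `w`, lies between the edges `x` and `e` into `v`, so `P₃ᴵ` also yields
    -- a path from `w` back to `v`.
    ... | inj₂ x⪯a = ⊥-elim (acyclic v (→ᵛ-trans v→w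
      (p₃ w v (v≢w ∘ sym) (a , proj₁ a-min , hull-intro (I? v) x∈ e∈v x⪯a a⪯e))))

  P₃ᴵ⇒Anchoredᴵ : P₃ᴵ G _≺_ → Anchoredᴵ G _≺_
  P₃ᴵ⇒Anchoredᴵ p₃ v w v≢w (_ , m , _ , (m∈ , _) , _) (v⊆w , _) =
    p₃ v w v≢w (m , m∈ , v⊆w (⊆-hull (I? v) m∈))

  -- If an output edge `e` lay in the hull of `I v`, anchoring would give a path leaving the sink
  -- `tgt e`. The required inclusion comes from `U₃ᴵ`; it is strict because `e` is the only edge
  -- into its sink.
  Anchoredᴵ⇒U₄ᴵ : U₃ᴵ G _≺_ → Anchoredᴵ G _≺_ → U₄ᴵ G _≺_
  Anchoredᴵ⇒U₄ᴵ u₃ anchored v (_ , ¬sink) {e} (sink , e∈@(a , _ , (a∈ , _) , _)) =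
    no-exit (anchored (tgt e) v t≢v (e , ⊆-hull (I? _) refl) (u₃ (tgt e) v (e , refl , e∈) , v⊈t))
    where
    t≢v : tgt e ≢ v
    t≢v refl = ¬sink sink

    no-exit : ¬ (tgt e →ᵛ v)
    no-exit (f , _ , f∈ , _) = sink f f∈

    v⊈t : ¬ (hull _≺_ (I v) ⊆ hull _≺_ (I (tgt e)))
    v⊈t v⊆t with v⊆t (⊆-hull (I? v) a∈)
    ... | m , M , (m∈ , _) , (M∈ , _) , m⪯a , a⪯M
      with sink⇒I-unique sink m∈ refl | sink⇒I-unique sink M∈ refl
    ... | refl | refl with ⪯-antisym m⪯a a⪯M
    ... | refl = t≢v a∈

  next-in-hull : Splitting G _≺_ → U₃ᴵ G _≺_ → U₄ᴵ G _≺_ →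
                 ∀ {v e} → tgt e ≢ v → e ∈ hull _≺_ (I v) →
                 ∃ λ o → tgt e ≡ src o × o ∈ hull _≺_ (I v)
  next-in-hull split u₃ u₄ {v} {e} t≢v e∈ with hull-bounds t≢v e∈
  ... | a , b , a∈ , (b∈ , b-max) , a≺e , e≺b
    with outgoing (λ sink → u₄ v (between⇒processive a∈ b∈ a≺e e≺b) (sink , e∈))
  ... | o , o∈ with compare b o
  ... | tri≈ _ refl _ = o , sym o∈ , ⊆-hull (I? v) b∈
  ... | tri> _ _ o≺b  = o , sym o∈ ,
    hull-intro (I? v) a∈ b∈ (inj₁ (≺-trans a≺e (consecutive⇒≺ (sym o∈)))) (inj₁ o≺b)
  -- Now `o` overshoots `b`, the last edge into `v`, so `b` lies strictly between the consecutive
  -- edges `e` and `o`. If it is in the hull of the edges leaving `tgt e`, their minimum replaces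
  -- `o`.
  ... | tri< b≺o _ _ with split refl o∈ e≺b b≺o
  ... | inj₂ (m , _ , (m∈ , _) , _ , m⪯b , _) = m , sym m∈ ,
    hull-intro (I? v) a∈ b∈ (inj₁ (≺-trans a≺e (consecutive⇒≺ (sym m∈)))) m⪯b
  -- The last edge `M` into `tgt e` is at least `b`, and by `U₃ᴵ` at most `b`. Hence `M` is `b`, and
  -- `tgt e` would be `v`.
  ... | inj₁ (_ , M , _ , (M∈ , _) , _ , b⪯M) = ⊥-elim (t≢v (trans (sym M∈) M∈v))
    where
    M⪯b : M ⪯ b
    M⪯b with u₃ (tgt e) v (e , refl , e∈) (⊆-hull (I? _) M∈)
    ... | _ , b′ , _ , (b′∈ , _) , _ , M⪯b′ = ⪯-trans M⪯b′ (b-max b′ b′∈)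

    M∈v : tgt M ≡ v
    M∈v with ⪯-antisym M⪯b b⪯M
    ... | refl = b∈

  U₃ᴵ∧U₄ᴵ⇒P₃ᴵ : Splitting G _≺_ → U₃ᴵ G _≺_ → U₄ᴵ G _≺_ → P₃ᴵ G _≺_
  U₃ᴵ∧U₄ᴵ⇒P₃ᴵ split u₃ u₄ v w v≢w (e , refl , e∈)
    with climb (spo-noetherian isStrictPartialOrder e) e∈
    where
    climb : ∀ {f} → Acc (flip _≺_) f → f ∈ hull _≺_ (I w) →
            ∃ λ i → DirectedPath f i × i ∈ I w
    climb {f} (acc rs) f∈ with tgt f ≟ w
    ... | yes f∈I = f , ε , f∈I
    ... | no t≢w with next-in-hull split u₃ u₄ t≢w f∈
    ... | o , s , o∈ with climb (rs (consecutive⇒≺ s)) o∈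
    ... | i , p , i∈ = i , s ◅ p , i∈
  ... | i , p , refl = path⇒tgt→ᵛ p v≢w

-- The two-sided conditions and their equivalence.

module Equivalences (G : DirectedGraph) (isProcessive : IsProcessive G)
  (_≺_ : Rel (DirectedGraph.Edge G) 0ℓ) (sto : IsStrictTotalOrder _≡_ _≺_)
  (p₁ : P₁ G _≺_) where

  open DirectedGraph G
  open Paths G
  open Duality G _≺_
  open IsStrictTotalOrder sto using (compare; irrefl)
  open Hull sto
  module In  = Incoming G isProcessive _≺_ sto p₁
  module Out = Incoming (G ᵒᵖ) (isProcessive-op isProcessive) (flip _≺_)
                 (Flip.isStrictTotalOrder sto) (P₁-op p₁)
  open Equivalence

  E? : ∀ v → Decidable (E v)
  E? v = I? v ∪? O? v

  U₂⇒Splitting : U₂ G _≺_ → Splitting G _≺_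
  U₂⇒Splitting u₂ {v} i∈ o∈ i≺y y≺o =
    proj₁ (proj₂ (u₂ v)) (hull-intro (E? v) (inj₁ i∈) (inj₂ o∈) (inj₁ i≺y) (inj₁ y≺o))

  P₂⇒U₂ : P₂ G _≺_ → U₂ G _≺_
  P₂⇒U₂ p₂ v = disjoint , split ,
    Sum.[ hull-least (⊆-hull (E? v) ∘ inj₁) , hull-least (⊆-hull (E? v) ∘ inj₂) ]
    where
    I≺O : ∀ {i o} → i ∈ I v → o ∈ O v → i ≺ o
    I≺O i∈ o∈ = In.consecutive⇒≺ (trans i∈ (sym o∈))

    disjoint : hull _≺_ (I v) ⊥ hull _≺_ (O v)
    disjoint ((_ , M , _ , (M∈ , _) , _ , y⪯M) , (m , _ , (m∈ , _) , _ , m⪯y , _)) =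
      ≺⇒⋡ (I≺O M∈ m∈) (⪯-trans m⪯y y⪯M)

    split : hull _≺_ (E v) ⊆ hull _≺_ (I v) ∪ hull _≺_ (O v)
    split (_ , _ , (inj₁ a∈ , _) , (inj₁ b∈ , _) , a⪯y , y⪯b) =
      inj₁ (hull-intro (I? v) a∈ b∈ a⪯y y⪯b)
    split (_ , _ , (inj₂ a∈ , _) , (inj₂ b∈ , _) , a⪯y , y⪯b) =
      inj₂ (hull-intro (O? v) a∈ b∈ a⪯y y⪯b)
    split (_ , _ , (inj₂ a∈ , _) , (inj₁ b∈ , _) , a⪯y , y⪯b) =
      ⊥-elim (≺⇒⋡ (I≺O b∈ a∈) (⪯-trans a⪯y y⪯b))
    split (_ , _ , (inj₁ a∈ , _) , (inj₂ b∈ , _) , inj₂ refl , _) = inj₁ (⊆-hull (I? v) a∈)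
    split (_ , _ , (inj₁ a∈ , _) , (inj₂ b∈ , _) , _ , inj₂ refl) = inj₂ (⊆-hull (O? v) b∈)
    -- Only this case needs `P₂`: a path from `a` to `y` has its second edge in `O v`, at most `y`,
    -- while a path from `y` to `b` has its last edge but one in `I v`, at least `y`.
    split (a , b , (inj₁ a∈ , _) , (inj₂ b∈ , _) , inj₁ a≺y , inj₁ y≺b)
      with p₂ a _ b a≺y y≺b ((λ a≡b → irrefl a≡b (I≺O a∈ b∈)) , trans a∈ (sym b∈) ◅ ε)
    ... | inj₁ (a≢y , ε)     = ⊥-elim (a≢y refl)
    ... | inj₁ (_   , s ◅ p) =
      inj₂ (hull-intro (O? v) (trans (sym s) a∈) b∈ (In.path⇒⪯ p) (inj₁ y≺b))
    ... | inj₂ (y≢b , p) with path-init p y≢b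
    ... | i , q , i∈ =
      inj₁ (hull-intro (I? v) a∈ (trans i∈ b∈) (inj₁ a≺y) (In.path⇒⪯ q))

  P₂⇒P₃ : P₂ G _≺_ → P₃ G _≺_
  P₂⇒P₃ p₂ = from P₃⇔ (In.P₂⇒P₃ᴵ p₂ , Out.P₂⇒P₃ᴵ (P₂-op p₂))

  P₃⇒P₂ : Splitting G _≺_ → P₃ G _≺_ → P₂ G _≺_
  P₃⇒P₂ split p₃ _ _ _ e≺y y≺g (_ , p) =
    Sum.map ((λ e≡y → irrefl e≡y e≺y) ,_) ((λ y≡g → irrefl y≡g y≺g) ,_) (through e≺y y≺g p)
    where
    through : ∀ {e y g} → e ≺ y → y ≺ g → DirectedPath e g → DirectedPath e y ⊎ DirectedPath y g
    through e≺y y≺e ε = ⊥-elim (≺⇒⋡ e≺y (inj₁ y≺e))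
    through {e} {y} e≺y y≺g (_◅_ {j = f} s p) with compare f y
    ... | tri≈ _ refl _ = inj₁ (s ◅ ε)
    ... | tri< f≺y _ _  = Sum.map₁ (s ◅_) (through f≺y y≺g p)
    -- The hull containing `y` decides the alternative: from the incoming one `y` reaches `tgt e`
    -- and continues along `f`, and from the outgoing one `e` reaches `y` through `tgt e`.
    ... | tri> _ _ y≺f with split {tgt e} refl (sym s) e≺y y≺f
    ... | inj₁ y∈I with tgt y ≟ tgt e
    ...   | yes t≡t = inj₂ (trans t≡t s ◅ p)
    ...   | no t≢t with proj₁ (p₃ (tgt y) (tgt e) t≢t) (y , refl , y∈I)
    ...     | _ , _ , h∈ , q , k∈ = inj₂ (sym h∈ ◅ q ◅◅ (trans k∈ s ◅ p))
    through {e} {y} e≺y y≺g (s ◅ p) | tri> _ _ y≺f | inj₂ y∈O with src y ≟ tgt e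
    ...   | yes s≡t = inj₁ (sym s≡t ◅ ε)
    ...   | no s≢t with proj₂ (p₃ (src y) (tgt e) s≢t) (y , refl , y∈O)
    ...     | _ , _ , h∈ , q , k∈ = inj₁ (sym h∈ ◅ q ◅◅ (k∈ ◅ ε))

  P₃⇒U₃ : P₃ G _≺_ → U₃ G _≺_
  P₃⇒U₃ p₃ with to P₃⇔ p₃
  ... | p₃ᴵ , p₃ᴼ = from U₃⇔ (In.P₃ᴵ⇒U₃ᴵ p₃ᴵ , Out.P₃ᴵ⇒U₃ᴵ p₃ᴼ)

  P₃⇒Anchored : P₃ G _≺_ → Anchored G _≺_
  P₃⇒Anchored p₃ with to P₃⇔ p₃
  ... | p₃ᴵ , p₃ᴼ = from Anchored⇔ (In.P₃ᴵ⇒Anchoredᴵ p₃ᴵ , Out.P₃ᴵ⇒Anchoredᴵ p₃ᴼ)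

  U₃∧Anchored⇒U₄ : U₃ G _≺_ → Anchored G _≺_ → U₄ G _≺_
  U₃∧Anchored⇒U₄ u₃ anchored with to U₃⇔ u₃ | to Anchored⇔ anchored
  ... | u₃ᴵ , u₃ᴼ | aᴵ , aᴼ = from U₄⇔ (In.Anchoredᴵ⇒U₄ᴵ u₃ᴵ aᴵ , Out.Anchoredᴵ⇒U₄ᴵ u₃ᴼ aᴼ)

  U₃∧U₄⇒P₃ : Splitting G _≺_ → U₃ G _≺_ → U₄ G _≺_ → P₃ G _≺_
  U₃∧U₄⇒P₃ split u₃ u₄ with to U₃⇔ u₃ | to U₄⇔ u₄
  ... | u₃ᴵ , u₃ᴼ | u₄ᴵ , u₄ᴼ =
    from P₃⇔ (In.U₃ᴵ∧U₄ᴵ⇒P₃ᴵ split u₃ᴵ u₄ᴵ , Out.U₃ᴵ∧U₄ᴵ⇒P₃ᴵ (Splitting-op split) u₃ᴼ u₄ᴼ)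

  POP⇒U₂∧P₃ : IsPOPGraph G _≺_ → U₂ G _≺_ × P₃ G _≺_
  POP⇒U₂∧P₃ pop = P₂⇒U₂ p₂ , P₂⇒P₃ p₂
    where open IsPOPGraph pop using (p₂)

  U₂∧P₃⇒POP : U₂ G _≺_ × P₃ G _≺_ → IsPOPGraph G _≺_
  U₂∧P₃⇒POP (u₂ , p₃) = record
    { isProcessive       = isProcessive
    ; isStrictTotalOrder = sto
    ; p₁                 = p₁
    ; p₂                 = P₃⇒P₂ (U₂⇒Splitting u₂) p₃
    }

  U₂∧P₃⇒AnchoredUPO : U₂ G _≺_ × P₃ G _≺_ → IsAnchoredUPOGraph G _≺_
  U₂∧P₃⇒AnchoredUPO (u₂ , p₃) = record
    { isUPOGraph = record { isStrictTotalOrder = sto ; u₁ = p₁ ; u₂ = u₂ ; u₃ = P₃⇒U₃ p₃ }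
    ; anchored   = P₃⇒Anchored p₃
    }

  AnchoredUPO⇒U₂∧U₃∧U₄ : IsAnchoredUPOGraph G _≺_ → U₂ G _≺_ × U₃ G _≺_ × U₄ G _≺_
  AnchoredUPO⇒U₂∧U₃∧U₄ upo = u₂ , u₃ , U₃∧Anchored⇒U₄ u₃ anchored
    where
    open IsAnchoredUPOGraph upo
    open IsUPOGraph isUPOGraph using (u₂; u₃)

  U₂∧U₃∧U₄⇒U₂∧P₃ : U₂ G _≺_ × U₃ G _≺_ × U₄ G _≺_ → U₂ G _≺_ × P₃ G _≺_
  U₂∧U₃∧U₄⇒U₂∧P₃ (u₂ , u₃ , u₄) = u₂ , U₃∧U₄⇒P₃ (U₂⇒Splitting u₂) u₃ u₄

theorem4p6 : (G : DirectedGraph) → IsProcessive G →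
    (_≺_ : Rel (DirectedGraph.Edge G) 0ℓ) → IsStrictTotalOrder _≡_ _≺_ →
    P₁ G _≺_ →
    (IsPOPGraph G _≺_ ⇔ (U₂ G _≺_ × P₃ G _≺_)) ×
    ((U₂ G _≺_ × P₃ G _≺_) ⇔ IsAnchoredUPOGraph G _≺_) ×
    (IsAnchoredUPOGraph G _≺_ ⇔ (U₂ G _≺_ × U₃ G _≺_ × U₄ G _≺_))
theorem4p6 G isProcessive _≺_ sto p₁ =
  mk⇔ POP⇒U₂∧P₃ U₂∧P₃⇒POP ,
  -- The converse here passes through condition (4), and the converse of the last equivalence
  -- through condition (2).
  mk⇔ U₂∧P₃⇒AnchoredUPO (U₂∧U₃∧U₄⇒U₂∧P₃ ∘ AnchoredUPO⇒U₂∧U₃∧U₄) ,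
  mk⇔ AnchoredUPO⇒U₂∧U₃∧U₄ (U₂∧P₃⇒AnchoredUPO ∘ U₂∧U₃∧U₄⇒U₂∧P₃)
  where open Equivalences G isProcessive _≺_ sto p₁
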